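{- Let $n\ge 4$, $0\le k\le n-2$, and let $G\in\mathfrak{H}_{n,k}$, i.e. $G$ is a connected graph on $n$ vertices with exactly $k$ pendant vertices. Then: (i) For $0\le k\le n-3$, $W(P_n^k)\le W(G)$, and equality holds if and only if $G=P_n^k$. Furthermore, $W(P_n^k)=\binom{n-k}{2}+k^2+2k(n-k-1)$. (ii) For $k=n-2$, $W(T(1,n-3,2))\le W(G)$, and equality holds if and only if $G=T(1,n-3,2)$. Furthermore, $W(T(1,n-3,2))=n^2-n-2$.
   Context: All graphs are finite, simple, connected and undirected; equality of graphs means isomorphism. The Wiener index of a connected graph $G$ is $W(G)=\sum_{\{u,v\}\subseteq V(G)}d_G(u,v)$, where the sum is over unordered pairs of vertices and $d_G$ is the shortest-path distance. A pendant vertex is a vertex of degree one. $\mathfrak{H}_{n,k}$ is the class of all connected graphs on $n$ vertices with exactly $k$ pendant vertices. For $0\le k\le n-3$ and $n\ge 4$, $P_n^k$ is the graph obtained by adding $k$ pendant vertices at one vertex of the complete graph $K_{n-k}$. For positive integers $a,b,d$, $T(a,b,d)$ is the tree on $a+b+d$ vertices obtained from the path $v_1v_2\ldots v_d$ on $d$ vertices by adding $a$ pendant vertices adjacent to $v_1$ and $b$ pendant vertices adjacent to $v_d$. -}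

module Defs where

open import Data.Empty using (⊥)
open import Data.Bool.Base using (if_then_else_)
open import Data.Fin.Base as Fin using (Fin; zero; suc; toℕ; fromℕ; fromℕ<; splitAt; join; _↑ˡ_)
open import Data.Fin.Properties as Fin using (any?; _<?_; splitAt-↑ˡ; splitAt-↑ʳ; join-splitAt)
open import Data.List.Base using (length; filter; allFin)
open import Data.Nat.Base using (ℕ; zero; suc; _+_; _∸_; _≤_; _<_; z≤n; s≤s; NonZero)
open import Data.Nat.Properties as ℕ
  using (+-0-commutativeMonoid; m<n⇒0<n∸m; ≤-trans; ≤-<-trans; ∸-monoʳ-<; 1+n≢n)
open import Data.Product.Base using (∃; _×_; _,_; proj₁; proj₂)
open import Data.Sum.Base as Sum using (_⊎_; inj₁; inj₂)
open import Function.Bundles using (_↔_; _⇔_; Inverse)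
open import Level using (0ℓ)
open import Relation.Binary.Construct.Closure.ReflexiveTransitive using (Star; ε; _◅_; _◅◅_; gmap; reverse)
open import Relation.Binary.Core using (Rel)
open import Relation.Binary.Definitions using (Decidable; Symmetric; Irreflexive)
open import Relation.Binary.PropositionalEquality
  using (_≡_; _≢_; refl; sym; cong; subst; subst₂; ≢-sym)
open import Relation.Nullary.Decidable using (yes; no; does; ¬?; map′; _×-dec_; _⊎-dec_)
open import Relation.Nullary.Negation using (contradiction)
open import Relation.Unary using (Pred) renaming (Decidable to Decidable₁)

open import Algebra.Properties.CommutativeMonoid.Sum +-0-commutativeMonoid using (sum-syntax)

record Graph (n : ℕ) : Set₁ where
  field
    _~_         : Rel (Fin n) 0ℓ
    _~?_        : Decidable _~_
    ~-sym       : Symmetric _~_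
    ~-irrefl    : Irreflexive _≡_ _~_
    ~-connected : ∀ u v → Star _~_ u v

record _≅_ {m n : ℕ} (G : Graph m) (H : Graph n) : Set where
  private
    module G = Graph G
    module H = Graph H
  field
    bijection : Fin m ↔ Fin n
  open Inverse bijection public using (to; from)
  field
    adjacency : ∀ u v → (u G.~ v) ⇔ (to u H.~ to v)

infix 4 _≅_

-- Walk _~_ ℓ u v: walks with exactly ℓ edges.
data Walk {n : ℕ} (_~_ : Rel (Fin n) 0ℓ) : ℕ → Rel (Fin n) 0ℓ where
  []  : ∀ {u} → Walk _~_ 0 u u
  _∷_ : ∀ {ℓ u w v} → u ~ w → Walk _~_ ℓ w v → Walk _~_ (suc ℓ) u v

infixr 5 _∷_

module _ {n : ℕ} {_~_ : Rel (Fin n) 0ℓ} where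

  fromStar : ∀ {u v} → Star _~_ u v → ∃ λ ℓ → Walk _~_ ℓ u v
  fromStar ε       = 0 , []
  fromStar (e ◅ s) = let ℓ , w = fromStar s in suc ℓ , e ∷ w

  walk? : Decidable _~_ → ∀ ℓ → Decidable (Walk _~_ ℓ)
  walk? _~?_ zero    u v = map′ (λ { refl → [] }) (λ { [] → refl }) (u Fin.≟ v)
  walk? _~?_ (suc ℓ) u v =
    map′ (λ { (_ , e , p) → e ∷ p }) (λ { (e ∷ p) → _ , e , p })
         (any? λ w → (u ~? w) ×-dec walk? _~?_ ℓ w v)

least : {P : Pred ℕ 0ℓ} → Decidable₁ P → ∃ P →
        ∃ λ m → P m × (∀ j → P j → m ≤ j)
least {P} P? (m , pm) = go P? m pm
  where
  go : {Q : Pred ℕ 0ℓ} → Decidable₁ Q → ∀ m → Q m →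
       ∃ λ m → Q m × (∀ j → Q j → m ≤ j)
  go Q? zero    qm = zero , qm , λ _ _ → z≤n
  go Q? (suc m) qm with Q? zero
  ... | yes q0 = zero , q0 , λ _ _ → z≤n
  ... | no ¬q0 =
    let i , qi , min = go (λ j → Q? (suc j)) m qm
    in suc i , qi , λ { zero    q → contradiction q ¬q0
                      ; (suc j) q → s≤s (min j q) }

module _ {n : ℕ} (G : Graph n) where
  open Graph G

  -- A shortest walk repeats no vertex, so minimising over walks or over
  -- paths gives the same number.
  shortest : ∀ u v → ∃ λ d → Walk _~_ d u v × (∀ ℓ → Walk _~_ ℓ u v → d ≤ ℓ)
  shortest u v = least (λ ℓ → walk? _~?_ ℓ u v) (fromStar (~-connected u v))

  dist : Fin n → Fin n → ℕ
  dist u v = proj₁ (shortest u v)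

  -- Each unordered pair {u, v} is counted once, as the ordered pair with u < v.
  W : ℕ
  W = ∑[ u < n ] ∑[ v < n ] (if does (u <? v) then dist u v else 0)

  degree : Fin n → ℕ
  degree v = length (filter (v ~?_) (allFin n))

  #pendant : ℕ
  #pendant = length (filter (λ v → degree v ℕ.≟ 1) (allFin n))

ℌ : (n k : ℕ) → Pred (Graph n) 0ℓ
ℌ n k G = #pendant G ≡ k

complete : ∀ m → Graph m
complete m = record
  { _~_         = _≢_
  ; _~?_        = λ u v → ¬? (u Fin.≟ v)
  ; ~-sym       = ≢-sym
  ; ~-irrefl    = λ u≡v u≢v → u≢v u≡v
  ; ~-connected = conn
  }
  where
  conn : ∀ u v → Star _≢_ u v
  conn u v with u Fin.≟ v
  ... | yes refl = ε
  ... | no  u≢v  = u≢v ◅ ε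

path : ∀ d → Graph d
path d = record
  { _~_         = _~_
  ; _~?_        = λ u v → (toℕ v ℕ.≟ suc (toℕ u)) ⊎-dec (toℕ u ℕ.≟ suc (toℕ v))
  ; ~-sym       = Sum.swap
  ; ~-irrefl    = λ { refl (inj₁ e) → 1+n≢n (sym e) ; refl (inj₂ e) → 1+n≢n (sym e) }
  ; ~-connected = conn d
  }
  where
  _~_ : ∀ {d} → Rel (Fin d) 0ℓ
  u ~ v = toℕ v ≡ suc (toℕ u) ⊎ toℕ u ≡ suc (toℕ v)

  fromZero : ∀ d (v : Fin (suc d)) → Star _~_ zero v
  fromZero _       zero    = ε
  fromZero (suc d) (suc v) =
    inj₁ refl ◅ gmap suc (Sum.map (cong suc) (cong suc)) (fromZero d v)

  conn : ∀ d (u v : Fin d) → Star _~_ u v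
  conn (suc d) u v = reverse Sum.swap (fromZero d u) ◅◅ fromZero d v

-- The old vertices are the first m elements of Fin (m + k), and the k pendant
-- vertices adjacent to r are the last k.
module _ {m : ℕ} (G : Graph m) (r : Fin m) (k : ℕ) where
  private
    open module G = Graph G using (_~_; _~?_)

  Adj : Rel (Fin m ⊎ Fin k) 0ℓ
  Adj (inj₁ u) (inj₁ v) = u ~ v
  Adj (inj₁ u) (inj₂ _) = u ≡ r
  Adj (inj₂ _) (inj₁ v) = v ≡ r
  Adj (inj₂ _) (inj₂ _) = ⊥

  adj? : Decidable Adj
  adj? (inj₁ u) (inj₁ v) = u ~? v
  adj? (inj₁ u) (inj₂ _) = u Fin.≟ r
  adj? (inj₂ _) (inj₁ v) = v Fin.≟ r
  adj? (inj₂ _) (inj₂ _) = no λ ()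

  adj-sym : Symmetric Adj
  adj-sym {inj₁ _} {inj₁ _} e = G.~-sym e
  adj-sym {inj₁ _} {inj₂ _} e = e
  adj-sym {inj₂ _} {inj₁ _} e = e

  adj-irrefl : Irreflexive _≡_ Adj
  adj-irrefl {inj₁ _} refl e = G.~-irrefl refl e

  Adj′ : Rel (Fin (m + k)) 0ℓ
  Adj′ x y = Adj (splitAt m x) (splitAt m y)

  old-adj : ∀ {u v} → u ~ v → Adj′ (u ↑ˡ k) (v ↑ˡ k)
  old-adj {u} {v} =
    subst₂ Adj (sym (splitAt-↑ˡ m u k)) (sym (splitAt-↑ˡ m v k))

  new-adj : ∀ i → Adj′ (m Fin.↑ʳ i) (r ↑ˡ k)
  new-adj i =
    subst₂ Adj (sym (splitAt-↑ʳ m k i)) (sym (splitAt-↑ˡ m r k)) refl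

  toRoot : ∀ s → Star Adj′ (join m k s) (r ↑ˡ k)
  toRoot (inj₁ u) = gmap (_↑ˡ k) old-adj (G.~-connected u r)
  toRoot (inj₂ i) = new-adj i ◅ ε

  toRoot′ : ∀ x → Star Adj′ x (r ↑ˡ k)
  toRoot′ x = subst (λ y → Star Adj′ y (r ↑ˡ k)) (join-splitAt m k x) (toRoot (splitAt m x))

  adj′-sym : Symmetric Adj′
  adj′-sym {x} {y} = adj-sym {splitAt m x} {splitAt m y}

  addPendants : Graph (m + k)
  addPendants = record
    { _~_         = Adj′
    ; _~?_        = λ x y → adj? (splitAt m x) (splitAt m y)
    ; ~-sym       = λ {x} {y} → adj′-sym {x} {y}
    ; ~-irrefl    = λ {x} {y} x≡y → adj-irrefl {splitAt m x} {splitAt m y} (cong (splitAt m) x≡y)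
    ; ~-connected = λ x y → toRoot′ x ◅◅ reverse (λ {x} {y} → adj′-sym {x} {y}) (toRoot′ y)
    }

0<n∸k : ∀ {n k} → 4 ≤ n → k ≤ n ∸ 3 → 0 < n ∸ k
0<n∸k {n} 4≤n k≤n∸3 =
  m<n⇒0<n∸m (≤-<-trans k≤n∸3 (∸-monoʳ-< {n} {3} {0} (s≤s z≤n) (≤-trans (ℕ.n≤1+n 3) 4≤n)))

-- Pₙᵏ, with the pendant vertices attached to the first vertex of the clique;
-- by symmetry, the choice is immaterial.
P : (n k : ℕ) → .(4 ≤ n) → .(k ≤ n ∸ 3) → Graph (n ∸ k + k)
P n k 4≤n k≤n∸3 = addPendants (complete (n ∸ k)) (fromℕ< (0<n∸k 4≤n k≤n∸3)) k

T : (a b d : ℕ) → .{{NonZero a}} → .{{NonZero b}} → .{{NonZero d}} → Graph (d + a + b)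
T a b (suc d) = addPendants (addPendants (path (suc d)) zero a) (fromℕ d ↑ˡ a) b

4≤n⇒n∸3≢0 : ∀ {n} → 4 ≤ n → NonZero (n ∸ 3)
4≤n⇒n∸3≢0 (s≤s (s≤s (s≤s (s≤s _)))) = _

{-# OPTIONS --safe #-}
module Submission where

-- Split the vertices into m non-pendant ones, the core, and k pendant ones, the
-- pendant vertex i hanging at the core vertex a i.  All distances are then at
-- least those of the graph with the same a whose core is complete, namely
--   d(x, y) = [x ≢ y],  d(x, i) = 1 + [x ≢ a i],  d(i, j) = 2 [i ≢ j] + [a i ≢ a j],
-- and W attains this bound only if the core is complete.  Summed over ordered
-- pairs the bound depends on a only through the number of pairs of pendant
-- vertices hanging at different core vertices.  This number vanishes only for
-- constant a, which gives Pₙᵏ.  For k = n - 2 the core is an edge, neither end of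
-- which can be bare, so the number is 2bc with b, c ≥ 1 and b + c = n - 2, and it
-- is least for b = 1 or c = 1.

open import Defs
open import Data.Bool.Base using (if_then_else_)
open import Data.Empty using (⊥)
open import Data.Fin.Base using (Fin; zero; suc; splitAt; fromℕ<)
open import Data.Fin.Permutation using (Permutation; transpose; ↔⇒≡)
open import Data.Fin.Properties
  using (_≟_; _<?_; <-cmp; <-irrefl; pigeonhole; +↔⊎; splitAt-join)
open import Data.List.Base using (length; filter; tabulate)
open import Data.Nat.Base using (ℕ; zero; suc; pred; _+_; _*_; _∸_; _^_; _≤_; z≤n; s≤s)
open import Data.Nat.Combinatorics using (_C_; nC1≡n; nCk+nC[k+1]≡[n+1]C[k+1])
open import Data.Nat.Properties as ℕ
  using (+-0-commutativeMonoid; ≤-refl; ≤-trans; ≤-antisym; ≤-reflexive; module ≤-Reasoning)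
open import Data.Nat.Tactic.RingSolver using (solve-∀)
open import Data.Product.Base using (∃; ∃₂; Σ-syntax; _×_; _,_; proj₁; proj₂)
open import Data.Sum.Base as Sum using (_⊎_; inj₁; inj₂; [_,_])
open import Data.Sum.Function.Propositional using (_⊎-↔_)
open import Data.Sum.Properties using (inj₁-injective; inj₂-injective)
open import Function.Base using (_∘_; id; const)
open import Function.Bundles using (_↔_; _⇔_; Injection; Inverse; Equivalence; mk⇔)
open import Function.Properties.Inverse using (↔-refl; ↔-sym; ↔-trans; ↔⇒↣)
open import Function.Related.TypeIsomorphisms using (⊎-assoc; ⊎-comm)
open import Level using (0ℓ)
open import Relation.Binary.Construct.Closure.ReflexiveTransitive
  using (Star; ε; _◅_; kleisliStar)
open import Relation.Binary.Core using (Rel)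
open import Relation.Binary.Definitions using (tri<; tri≈; tri>)
open import Relation.Binary.PropositionalEquality hiding ([_])
open import Relation.Nullary.Decidable using (yes; no; does; dec-true; dec-false)
open import Relation.Nullary.Negation using (¬_; contradiction)
open import Relation.Unary using (_∈_; Pred) renaming (Decidable to Decidable₁)

open import Algebra.Properties.CommutativeMonoid.Sum +-0-commutativeMonoid
  using (sum-syntax; sum-cong-≗; ∑-distrib-+; ∑-comm; ∑-permute)

-- Sums over finite index sets.

∑-mono : ∀ {n} {f g : Fin n → ℕ} → (∀ i → f i ≤ g i) → ∑[ i < n ] f i ≤ ∑[ i < n ] g i
∑-mono {zero}  f≤g = z≤n
∑-mono {suc n} f≤g = ℕ.+-mono-≤ (f≤g zero) (∑-mono (f≤g ∘ suc))

-- No term has slack to spare: bounding the tail and cancelling it settles the head, and bounding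
-- the head and cancelling it leaves the hypothesis for the tail.
∑-mono-tight : ∀ {n} {f g : Fin n → ℕ} → (∀ i → f i ≤ g i) →
               ∑[ i < n ] g i ≤ ∑[ i < n ] f i → ∀ i → f i ≡ g i
∑-mono-tight {suc n} {f} {g} f≤g ∑g≤∑f = λ where
    zero    → ≤-antisym (f≤g zero) (ℕ.+-cancelʳ-≤ _ _ _
                (≤-trans ∑g≤∑f (ℕ.+-monoʳ-≤ (f zero) tail≤)))
    (suc i) → ∑-mono-tight (f≤g ∘ suc) (ℕ.+-cancelˡ-≤ (g zero) _ _
                (≤-trans ∑g≤∑f (ℕ.+-monoˡ-≤ _ (f≤g zero)))) i
  where
  tail≤ : ∑[ i < n ] f (suc i) ≤ ∑[ i < n ] g (suc i)
  tail≤ = ∑-mono (f≤g ∘ suc)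

∑-const : ∀ n c → ∑[ i < n ] c ≡ n * c
∑-const zero    c = refl
∑-const (suc n) c = cong (c +_) (∑-const n c)

∑-*ˡ : ∀ {n} c (f : Fin n → ℕ) → ∑[ i < n ] (c * f i) ≡ c * ∑[ i < n ] f i
∑-*ˡ {zero}  c f = sym (ℕ.*-zeroʳ c)
∑-*ˡ {suc n} c f = trans (cong (c * f zero +_) (∑-*ˡ c (f ∘ suc)))
                         (sym (ℕ.*-distribˡ-+ c (f zero) _))

∑-splitAt : ∀ m {k} (f : Fin m ⊎ Fin k → ℕ) →
            ∑[ j < m + k ] f (splitAt m j) ≡ ∑[ x < m ] f (inj₁ x) + ∑[ i < k ] f (inj₂ i)
∑-splitAt zero    f = refl
∑-splitAt (suc m) f =
  trans (cong (f (inj₁ zero) +_) (∑-splitAt m (f ∘ Sum.map₁ suc)))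
        (sym (ℕ.+-assoc (f (inj₁ zero)) _ _))

module _ {n m k : ℕ} (e : Fin n ↔ (Fin m ⊎ Fin k)) where
  open Inverse e using (to; from; strictlyInverseˡ)

  ∑-⊎ : (f : Fin m ⊎ Fin k → ℕ) →
        ∑[ u < n ] f (to u) ≡ ∑[ x < m ] f (inj₁ x) + ∑[ i < k ] f (inj₂ i)
  ∑-⊎ f = begin
    ∑[ u < n ] f (to u)                        ≡⟨ ∑-permute (f ∘ to) (↔-trans (+↔⊎ {m}) (↔-sym e)) ⟩
    ∑[ j < m + k ] f (to (from (splitAt m j))) ≡⟨ sum-cong-≗ (cong f ∘ strictlyInverseˡ ∘ splitAt m) ⟩
    ∑[ j < m + k ] f (splitAt m j)             ≡⟨ ∑-splitAt m f ⟩
    ∑[ x < m ] f (inj₁ x) + ∑[ i < k ] f (inj₂ i) ∎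
    where open ≡-Reasoning

  ∑∑-⊎ : (f : Fin m ⊎ Fin k → Fin m ⊎ Fin k → ℕ) →
         ∑[ u < n ] ∑[ v < n ] f (to u) (to v) ≡
           (∑[ x < m ] ∑[ y < m ] f (inj₁ x) (inj₁ y) + ∑[ x < m ] ∑[ j < k ] f (inj₁ x) (inj₂ j))
         + (∑[ i < k ] ∑[ y < m ] f (inj₂ i) (inj₁ y) + ∑[ i < k ] ∑[ j < k ] f (inj₂ i) (inj₂ j))
  ∑∑-⊎ f = begin
    ∑[ u < n ] ∑[ v < n ] f (to u) (to v)
      ≡⟨ sum-cong-≗ (λ u → ∑-⊎ (f (to u))) ⟩
    ∑[ u < n ] (∑[ y < m ] f (to u) (inj₁ y) + ∑[ j < k ] f (to u) (inj₂ j))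
      ≡⟨ ∑-⊎ (λ s → ∑[ y < m ] f s (inj₁ y) + ∑[ j < k ] f s (inj₂ j)) ⟩
    ∑[ x < m ] (∑[ y < m ] f (inj₁ x) (inj₁ y) + ∑[ j < k ] f (inj₁ x) (inj₂ j))
      + ∑[ i < k ] (∑[ y < m ] f (inj₂ i) (inj₁ y) + ∑[ j < k ] f (inj₂ i) (inj₂ j))
      ≡⟨ cong₂ _+_ (∑-distrib-+ {m} _ _) (∑-distrib-+ {k} _ _) ⟩
    _ ∎
    where open ≡-Reasoning

-- The indicator of inequality, which is the distance in a complete graph.

[_≢_] : ∀ {n} → Fin n → Fin n → ℕ
[ x ≢ y ] = if does (x ≟ y) then 0 else 1

module _ {n : ℕ} where

  ≢-refl : (x : Fin n) → [ x ≢ x ] ≡ 0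
  ≢-refl x rewrite dec-true (x ≟ x) refl = refl

  ≢-true : {x y : Fin n} → x ≢ y → [ x ≢ y ] ≡ 1
  ≢-true {x} {y} x≢y rewrite dec-false (x ≟ y) x≢y = refl

  ≢-false⁻¹ : {x y : Fin n} → [ x ≢ y ] ≡ 0 → x ≡ y
  ≢-false⁻¹ {x} {y} e with x ≟ y
  ... | yes x≡y = x≡y

  ≢-≤1 : (x y : Fin n) → [ x ≢ y ] ≤ 1
  ≢-≤1 x y with x ≟ y
  ... | yes _ = z≤n
  ... | no  _ = ≤-refl

  ≢-swap : (x y : Fin n) → [ x ≢ y ] ≡ [ y ≢ x ]
  ≢-swap x y with x ≟ y
  ... | yes refl = sym (≢-refl x)
  ... | no  x≢y  = sym (≢-true (≢-sym x≢y))

∑-≢ : ∀ {n} (x : Fin n) → ∑[ y < n ] [ x ≢ y ] ≡ pred n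
∑-≢ {suc n}       zero    = trans (∑-const n 1) (ℕ.*-identityʳ n)
∑-≢ {suc (suc n)} (suc x) = cong suc (∑-≢ x)

∑∑-≢ : ∀ n → ∑[ x < n ] ∑[ y < n ] [ x ≢ y ] ≡ n * pred n
∑∑-≢ n = trans (sum-cong-≗ {n} ∑-≢) (∑-const n (pred n))

-- Walks, distances, and the Wiener index over ordered pairs.

module _ {n : ℕ} (G : Graph n) where
  open Graph G

  dist-walk : ∀ u v → Walk _~_ (dist G u v) u v
  dist-walk u v = proj₁ (proj₂ (shortest G u v))

  dist-≤ : ∀ {ℓ u v} → Walk _~_ ℓ u v → dist G u v ≤ ℓ
  dist-≤ {ℓ} {u} {v} = proj₂ (proj₂ (shortest G u v)) ℓ

  _∷ʳ_ : ∀ {ℓ u v w} → Walk _~_ ℓ u v → v ~ w → Walk _~_ (suc ℓ) u w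
  []      ∷ʳ f = f ∷ []
  (e ∷ p) ∷ʳ f = e ∷ (p ∷ʳ f)

  reverse-walk : ∀ {ℓ u v} → Walk _~_ ℓ u v → Walk _~_ ℓ v u
  reverse-walk []      = []
  reverse-walk (e ∷ p) = reverse-walk p ∷ʳ ~-sym e

  dist-sym : ∀ u v → dist G u v ≡ dist G v u
  dist-sym u v = ≤-antisym (dist-≤ (reverse-walk (dist-walk v u)))
                           (dist-≤ (reverse-walk (dist-walk u v)))

  dist-refl : ∀ u → dist G u u ≡ 0
  dist-refl u = ℕ.n≤0⇒n≡0 (dist-≤ {u = u} [])

  -- A second copy of the sum with its indices exchanged supplies the pairs with `v < u`, since
  -- distances are symmetric, and the diagonal contributes 0. Ordered pairs are preferred because
  -- their sum can be reindexed by any bijection of the vertices.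
  2*W : 2 * W G ≡ ∑[ u < n ] ∑[ v < n ] dist G u v
  2*W = begin
    2 * W G
      ≡⟨ cong (W G +_) (ℕ.+-identityʳ (W G)) ⟩
    W G + W G
      ≡⟨ cong (W G +_) (∑-comm upper) ⟩
    W G + ∑[ u < n ] ∑[ v < n ] upper v u
      ≡⟨ ∑-distrib-+ {n} _ _ ⟨
    ∑[ u < n ] (∑[ v < n ] upper u v + ∑[ v < n ] upper v u)
      ≡⟨ sum-cong-≗ {n} (λ u → ∑-distrib-+ (upper u) (λ v → upper v u)) ⟨
    ∑[ u < n ] ∑[ v < n ] (upper u v + upper v u)
      ≡⟨ sum-cong-≗ {n} (λ u → sum-cong-≗ {n} (upper+lower u)) ⟩
    ∑[ u < n ] ∑[ v < n ] dist G u v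
      ∎
    where
    open ≡-Reasoning
    upper : Fin n → Fin n → ℕ
    upper u v = if does (u <? v) then dist G u v else 0

    upper+lower : ∀ u v → upper u v + upper v u ≡ dist G u v
    upper+lower u v with <-cmp u v
    ... | tri< u<v _ v≮u rewrite dec-true (u <? v) u<v | dec-false (v <? u) v≮u = ℕ.+-identityʳ _
    ... | tri> u≮v _ v<u rewrite dec-false (u <? v) u≮v | dec-true (v <? u) v<u = dist-sym v u
    ... | tri≈ u≮u refl _ rewrite dec-false (u <? u) u≮u = sym (dist-refl u)

-- Sorting a finite set by a decidable predicate.

insert₁ : ∀ {n m k} → Fin n ↔ (Fin m ⊎ Fin k) → Fin (suc n) ↔ (Fin (suc m) ⊎ Fin k)
insert₁ e = ↔-trans (+↔⊎ {1}) (↔-trans (↔-refl ⊎-↔ e)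
              (↔-trans (↔-sym (⊎-assoc 0ℓ _ _ _)) (↔-sym (+↔⊎ {1}) ⊎-↔ ↔-refl)))

insert₂ : ∀ {n m k} → Fin n ↔ (Fin m ⊎ Fin k) → Fin (suc n) ↔ (Fin m ⊎ Fin (suc k))
insert₂ e = ↔-trans (insert₁ (↔-trans e (⊎-comm _ _))) (⊎-comm _ _)

-- The size of the right block is the very expression that defines `degree` and `#pendant` (with
-- `f = id`), so neighbours and pendant vertices become indexed by a `Fin` of the right size. The
-- function `f` is general because the induction passes to `f ∘ suc`.
separate : ∀ {n} {A : Set} {Q : Pred A 0ℓ} (Q? : Decidable₁ Q) (f : Fin n → A) →
           ∃ λ m → Σ[ e ∈ Fin n ↔ (Fin m ⊎ Fin (length (filter Q? (tabulate f)))) ]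
             (∀ x → ¬ Q (f (Inverse.from e (inj₁ x)))) × (∀ i → Q (f (Inverse.from e (inj₂ i))))
separate {zero}  Q? f = 0 , +↔⊎ {0} , (λ ()) , λ ()
separate {suc n} Q? f with Q? (f zero) | separate Q? (f ∘ suc)
... | yes q | m , e , ¬Q , Q = m , insert₂ e , ¬Q , λ { zero → q ; (suc i) → Q i }
... | no ¬q | m , e , ¬Q , Q = suc m , insert₁ e , (λ { zero → ¬q ; (suc x) → ¬Q x }) , Q

-- Vertices of degree one.

module _ {n : ℕ} (G : Graph n) where
  open Graph G

  OnlyNeighbour : Fin n → Fin n → Set
  OnlyNeighbour v w = v ~ w × (∀ u → v ~ u → u ≡ w)

  neighbours : ∀ v → ∃ λ m → Σ[ e ∈ Fin n ↔ (Fin m ⊎ Fin (degree G v)) ]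
                 (∀ x → ¬ v ~ Inverse.from e (inj₁ x)) × (∀ i → v ~ Inverse.from e (inj₂ i))
  neighbours v = separate (v ~?_) id

  degree≡1⇒onlyNeighbour : ∀ {v} → degree G v ≡ 1 → ∃ (OnlyNeighbour v)
  degree≡1⇒onlyNeighbour {v} d≡1 = go d≡1 (neighbours v)
    where
    -- The degree is generalised to a variable `d`, so that the equation can be matched with `refl`.
    go : ∀ {d} → d ≡ 1 →
         (∃ λ m → Σ[ e ∈ Fin n ↔ (Fin m ⊎ Fin d) ]
           (∀ x → ¬ v ~ Inverse.from e (inj₁ x)) × (∀ i → v ~ Inverse.from e (inj₂ i))) →
         ∃ (OnlyNeighbour v)
    go refl (_ , e , non-nb , nb) = from (inj₂ zero) , nb zero , only
      where
      open Inverse e using (to; from; strictlyInverseʳ)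
      only : ∀ u → v ~ u → u ≡ from (inj₂ zero)
      only u v~u with to u in eq
      ... | inj₁ x    = contradiction
                          (subst (v ~_) (trans (sym (strictlyInverseʳ u)) (cong from eq)) v~u) (non-nb x)
      ... | inj₂ zero = trans (sym (strictlyInverseʳ u)) (cong from eq)

  -- The indices of the neighbours of `v` form a one-element set: the label of `w` is among them,
  -- and every index labels `w`.
  onlyNeighbour⇒degree≡1 : ∀ {v w} → OnlyNeighbour v w → degree G v ≡ 1
  onlyNeighbour⇒degree≡1 {v} {w} (v~w , only) with neighbours v
  ... | _ , e , non-nb , nb = subsingleton index (λ i j → inj₂-injective (trans (all i) (sym (all j))))
    where
    open Inverse e using (to; from; strictlyInverseˡ; strictlyInverseʳ)
    subsingleton : ∀ {d} → Fin d → (∀ (i j : Fin d) → i ≡ j) → d ≡ 1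
    subsingleton {1}           _ _     = refl
    subsingleton {suc (suc _)} _ all≡ with () ← all≡ zero (suc zero)

    index : Fin (degree G v)
    index with to w in eq
    ... | inj₁ x = contradiction
                     (subst (v ~_) (trans (sym (strictlyInverseʳ w)) (cong from eq)) v~w) (non-nb x)
    ... | inj₂ i = i

    all : ∀ i → inj₂ i ≡ to w
    all i = trans (sym (strictlyInverseˡ (inj₂ i))) (cong to (only _ (nb i)))

  -- A walk from `v` could never leave the set of `v` and `w`, so by connectedness these would be
  -- all the vertices; among three vertices two would then coincide.
  onlyNeighbour-asym : 3 ≤ n → ∀ {v w} → OnlyNeighbour v w → ¬ OnlyNeighbour w v
  onlyNeighbour-asym 3≤n {v} {w} (_ , only-v) (_ , only-w) =
    let i , j , i<j , same = pigeonhole 3≤n (λ u → side (endpoint u))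
    in <-irrefl (side-injective (endpoint i) (endpoint j) same) i<j
    where
    walk-stays : ∀ {x u} → x ≡ v ⊎ x ≡ w → Star _~_ x u → u ≡ v ⊎ u ≡ w
    walk-stays x∈         ε       = x∈
    walk-stays (inj₁ refl) (e ◅ s) = walk-stays (inj₂ (only-v _ e)) s
    walk-stays (inj₂ refl) (e ◅ s) = walk-stays (inj₁ (only-w _ e)) s

    endpoint : ∀ u → u ≡ v ⊎ u ≡ w
    endpoint u = walk-stays (inj₁ refl) (~-connected v u)

    side : ∀ {u} → u ≡ v ⊎ u ≡ w → Fin 2
    side = [ const zero , const (suc zero) ]

    side-injective : ∀ {u u′} (s : u ≡ v ⊎ u ≡ w) (s′ : u′ ≡ v ⊎ u′ ≡ w) →
                     side s ≡ side s′ → u ≡ u′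
    side-injective (inj₁ refl) (inj₁ refl) _ = refl
    side-injective (inj₂ refl) (inj₂ refl) _ = refl

-- Graphs described by a core and the attachments of pendant vertices.

-- A core Fin m with adjacency R, and pendant vertices Fin k with i hanging at a i.
module _ {m k : ℕ} (R : Rel (Fin m) 0ℓ) (a : Fin k → Fin m) where

  Hanging : Rel (Fin m ⊎ Fin k) 0ℓ
  Hanging (inj₁ x) (inj₁ y) = R x y
  Hanging (inj₁ x) (inj₂ j) = x ≡ a j
  Hanging (inj₂ i) (inj₁ y) = y ≡ a i
  Hanging (inj₂ i) (inj₂ j) = ⊥

  -- This amounts to an isomorphism onto the graph with adjacency `Hanging`, where the target is
  -- given only as a relation on the sum type.
  record Labelling {n : ℕ} (G : Graph n) : Set where
    open Graph G using (_~_)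
    field
      bijection : Fin n ↔ (Fin m ⊎ Fin k)
    open Inverse bijection public renaming (to to label; from to vertex)
    field
      adjacency : ∀ u v → u ~ v ⇔ Hanging (label u) (label v)

    edge : ∀ s t → Hanging s t → vertex s ~ vertex t
    edge s t h = Equivalence.from (adjacency _ _)
      (subst₂ Hanging (sym (strictlyInverseˡ s)) (sym (strictlyInverseˡ t)) h)

    edge⁻¹ : ∀ s t → vertex s ~ vertex t → Hanging s t
    edge⁻¹ s t e =
      subst₂ Hanging (strictlyInverseˡ s) (strictlyInverseˡ t) (Equivalence.to (adjacency _ _) e)

-- The distances for a complete core and their sum.

-- The distance in the labelled graph when the core is complete.
δ : ∀ {m k} → (Fin k → Fin m) → Fin m ⊎ Fin k → Fin m ⊎ Fin k → ℕ
δ a (inj₁ x) (inj₁ y) = [ x ≢ y ]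
δ a (inj₁ x) (inj₂ j) = suc [ x ≢ a j ]
δ a (inj₂ i) (inj₁ y) = suc [ a i ≢ y ]
δ a (inj₂ i) (inj₂ j) = 2 * [ i ≢ j ] + [ a i ≢ a j ]

split-pairs : ∀ {m k} → (Fin k → Fin m) → ℕ
split-pairs {k = k} a = ∑[ i < k ] ∑[ j < k ] [ a i ≢ a j ]

-- The share of the sum that does not depend on `a`: the core pairs, the two mixed blocks with
-- `m + pred m` for each pendant vertex, and 2 for each ordered pair of distinct pendant vertices.
δ-total : ℕ → ℕ → ℕ
δ-total m k = m * pred m + (2 * (k * (m + pred m)) + 2 * (k * pred k))

module _ {m k : ℕ} (a : Fin k → Fin m) where

  δ-refl : ∀ s → δ a s s ≡ 0
  δ-refl (inj₁ x) = ≢-refl x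
  δ-refl (inj₂ i) rewrite ≢-refl i = ≢-refl (a i)

  -- This is the induction step for bounding the length of a walk below by `δ`. On core edges it
  -- holds whatever `R` is, because there the indicators are at most 1; on the other edges `refl`
  -- identifies the core end with the attachment.
  δ-step : ∀ {R} s t r → Hanging R a s t → δ a s r ≤ suc (δ a t r)
  δ-step (inj₁ x) (inj₁ y) (inj₁ z) _    = ≤-trans (≢-≤1 x z) (s≤s z≤n)
  δ-step (inj₁ x) (inj₁ y) (inj₂ j) _    = s≤s (≤-trans (≢-≤1 x (a j)) (s≤s z≤n))
  δ-step (inj₁ x) (inj₂ i) (inj₁ z) refl = ℕ.m≤n⇒m≤1+n (ℕ.n≤1+n _)
  δ-step (inj₁ x) (inj₂ i) (inj₂ j) refl = s≤s (ℕ.m≤n+m _ _)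
  δ-step (inj₂ i) (inj₁ y) (inj₁ z) refl = ≤-refl
  δ-step (inj₂ i) (inj₁ y) (inj₂ j) refl =
    ℕ.+-monoˡ-≤ [ a i ≢ a j ] (ℕ.*-monoʳ-≤ 2 (≢-≤1 i j))

  -- Of the four blocks only the pendant-pendant one depends on `a`: in a mixed block, the distances
  -- from one pendant vertex to the core have the same sum wherever it hangs.
  ∑∑-δ : ∀ {n} (e : Fin n ↔ (Fin m ⊎ Fin k)) →
         ∑[ u < n ] ∑[ v < n ] δ a (Inverse.to e u) (Inverse.to e v) ≡ δ-total m k + split-pairs a
  ∑∑-δ e = begin
    _ ≡⟨ ∑∑-⊎ e (δ a) ⟩
    (∑[ x < m ] ∑[ y < m ] [ x ≢ y ] + ∑[ x < m ] ∑[ j < k ] suc [ x ≢ a j ])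
      + (∑[ i < k ] ∑[ y < m ] suc [ a i ≢ y ] + ∑[ i < k ] ∑[ j < k ] (2 * [ i ≢ j ] + [ a i ≢ a j ]))
      ≡⟨ cong₂ _+_ (cong₂ _+_ (∑∑-≢ m) core-pendant) (cong₂ _+_ pendant-core pendant-pendant) ⟩
    (m * pred m + k * (m + pred m)) + (k * (m + pred m) + (2 * (k * pred k) + split-pairs a))
      ≡⟨ collect (m * pred m) (k * (m + pred m)) (2 * (k * pred k)) (split-pairs a) ⟩
    δ-total m k + split-pairs a
      ∎
    where
    open ≡-Reasoning
    collect : ∀ p q r s → (p + q) + (q + (r + s)) ≡ p + (2 * q + r) + s
    collect = solve-∀

    row : ∀ (x : Fin m) → ∑[ y < m ] suc [ x ≢ y ] ≡ m + pred m
    row x = trans (∑-distrib-+ {m} (λ _ → 1) _)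
                  (cong₂ _+_ (trans (∑-const m 1) (ℕ.*-identityʳ m)) (∑-≢ x))

    pendant-core : ∑[ i < k ] ∑[ y < m ] suc [ a i ≢ y ] ≡ k * (m + pred m)
    pendant-core = trans (sum-cong-≗ {k} (row ∘ a)) (∑-const k _)

    core-pendant : ∑[ x < m ] ∑[ j < k ] suc [ x ≢ a j ] ≡ k * (m + pred m)
    core-pendant = trans (∑-comm (λ x j → suc [ x ≢ a j ]))
      (trans (sum-cong-≗ {k} (λ j → sum-cong-≗ {m} (λ x → cong suc (≢-swap x (a j))))) pendant-core)

    pendant-pendant : ∑[ i < k ] ∑[ j < k ] (2 * [ i ≢ j ] + [ a i ≢ a j ]) ≡
                      2 * (k * pred k) + split-pairs a
    pendant-pendant = trans (sum-cong-≗ {k} (λ i → ∑-distrib-+ {k} _ _)) (trans (∑-distrib-+ {k} _ _)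
      (cong (_+ split-pairs a) (trans (sum-cong-≗ {k} (λ i → ∑-*ˡ {k} 2 _))
        (trans (∑-*ˡ {k} 2 _) (cong (2 *_) (∑∑-≢ k))))))

-- The Wiener index compared with the sum of `δ`.

module _ {n m k : ℕ} {R : Rel (Fin m) 0ℓ} {a : Fin k → Fin m} {G : Graph n}
         (L : Labelling R a G) where
  open Graph G
  open Labelling L

  δ-≤-length : ∀ {ℓ u v} → Walk _~_ ℓ u v → δ a (label u) (label v) ≤ ℓ
  δ-≤-length {u = u} []          = ≤-reflexive (δ-refl a (label u))
  δ-≤-length {u = u} (_∷_ {w = w} e p) =
    ≤-trans (δ-step a {R} (label u) (label w) _ (Equivalence.to (adjacency u w) e)) (s≤s (δ-≤-length p))

  δ-≤-dist : ∀ u v → δ a (label u) (label v) ≤ dist G u v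
  δ-≤-dist u v = δ-≤-length (dist-walk G u v)

  2*W-≥ : δ-total m k + split-pairs a ≤ 2 * W G
  2*W-≥ = begin
    δ-total m k + split-pairs a                       ≡⟨ ∑∑-δ a bijection ⟨
    ∑[ u < n ] ∑[ v < n ] δ a (label u) (label v)     ≤⟨ ∑-mono (λ u → ∑-mono (δ-≤-dist u)) ⟩
    ∑[ u < n ] ∑[ v < n ] dist G u v                  ≡⟨ 2*W G ⟨
    2 * W G                                           ∎
    where open ≤-Reasoning

  -- Tightness of the double sum passes to its rows and then to its entries, so every distance
  -- equals `δ`. Distinct core vertices are then at distance 1, and a walk of length 1 is an edge.
  2*W-tight⇒complete : 2 * W G ≤ δ-total m k + split-pairs a → ∀ {x y} → x ≢ y → R x y
  2*W-tight⇒complete tight {x} {y} x≢y = edge⁻¹ (inj₁ x) (inj₁ y)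
    (step (subst (λ d → Walk _~_ d _ _) dist≡1 (dist-walk G _ _)))
    where
    δ≡dist : ∀ u v → δ a (label u) (label v) ≡ dist G u v
    δ≡dist u = ∑-mono-tight (δ-≤-dist u) (≤-reflexive (sym
      (∑-mono-tight (λ u → ∑-mono (δ-≤-dist u))
        (subst₂ _≤_ (2*W G) (sym (∑∑-δ a bijection)) tight) u)))

    dist≡1 : dist G (vertex (inj₁ x)) (vertex (inj₁ y)) ≡ 1
    dist≡1 = trans (sym (δ≡dist _ _))
      (trans (cong₂ (δ a) (strictlyInverseˡ (inj₁ x)) (strictlyInverseˡ (inj₁ y))) (≢-true x≢y))

    step : ∀ {u v} → Walk _~_ 1 u v → u ~ v
    step (e ∷ []) = e

  core-irrefl : ∀ {x} → ¬ R x x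
  core-irrefl {x} r = ~-irrefl refl (edge (inj₁ x) (inj₁ x) r)

  module _ (complete : ∀ {x y} → x ≢ y → R x y) where

    -- The route leaves a pendant vertex through its attachment, crosses the core by at most one
    -- edge and enters the other end through its attachment. Its length is the upper bound matching
    -- `δ-≤-dist`.
    δ-walk : ∀ s t → Walk _~_ (δ a s t) (vertex s) (vertex t)
    δ-walk (inj₁ x) (inj₁ y) with x ≟ y
    ... | yes refl = []
    ... | no  x≢y  = edge (inj₁ x) (inj₁ y) (complete x≢y) ∷ []
    δ-walk (inj₁ x) (inj₂ j) =
      _∷ʳ_ G (δ-walk (inj₁ x) (inj₁ (a j))) (edge (inj₁ (a j)) (inj₂ j) refl)
    δ-walk (inj₂ i) (inj₁ y) = edge (inj₂ i) (inj₁ (a i)) refl ∷ δ-walk (inj₁ (a i)) (inj₁ y)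
    δ-walk (inj₂ i) (inj₂ j) with i ≟ j
    ... | yes refl rewrite ≢-refl (a i) = []
    ... | no  _    =
      edge (inj₂ i) (inj₁ (a i)) refl ∷
      _∷ʳ_ G (δ-walk (inj₁ (a i)) (inj₁ (a j))) (edge (inj₁ (a j)) (inj₂ j) refl)

    dist-≤-δ : ∀ u v → dist G u v ≤ δ a (label u) (label v)
    dist-≤-δ u v = dist-≤ G (subst₂ (Walk _~_ _) (strictlyInverseʳ u) (strictlyInverseʳ v)
                                    (δ-walk (label u) (label v)))

    2*W-complete : 2 * W G ≡ δ-total m k + split-pairs a
    2*W-complete = begin
      2 * W G                                           ≡⟨ 2*W G ⟩
      ∑[ u < n ] ∑[ v < n ] dist G u v                  ≡⟨ sum-cong-≗ {n} (λ u → sum-cong-≗ {n} (λ v →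
                                                             ≤-antisym (dist-≤-δ u v) (δ-≤-dist u v))) ⟩
      ∑[ u < n ] ∑[ v < n ] δ a (label u) (label v)     ≡⟨ ∑∑-δ a bijection ⟩
      δ-total m k + split-pairs a                       ∎
      where open ≡-Reasoning

    -- A complete irreflexive core relation has the same pairs as `_≢_`. With the core in this
    -- common form, labelled graphs differ only in their attachments.
    clique : Labelling _≢_ a G
    clique = record
      { bijection = bijection
      ; adjacency = λ u v → mk⇔ (fwd (label u) (label v) ∘ Equivalence.to (adjacency u v))
                                (Equivalence.from (adjacency u v) ∘ bwd (label u) (label v))
      }
      where
      fwd : ∀ s t → Hanging R a s t → Hanging _≢_ a s t
      fwd (inj₁ x) (inj₁ y) r refl = core-irrefl r
      fwd (inj₁ _) (inj₂ _) h = h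
      fwd (inj₂ _) (inj₁ _) h = h
      bwd : ∀ s t → Hanging _≢_ a s t → Hanging R a s t
      bwd (inj₁ x) (inj₁ y) x≢y = complete x≢y
      bwd (inj₁ _) (inj₂ _) h = h
      bwd (inj₂ _) (inj₁ _) h = h

  -- Contracting each pendant vertex onto its attachment sends an edge of `G` to a core edge or to a
  -- single core vertex, so walks in `G` become walks in the core.
  core-connected : ∀ x y → Star R x y
  core-connected x y = subst₂ (λ s t → Star R (root s) (root t))
    (strictlyInverseˡ (inj₁ x)) (strictlyInverseˡ (inj₁ y))
    (kleisliStar (root ∘ label)
      (λ {u} {v} e → contract (label u) (label v) (Equivalence.to (adjacency u v) e))
      (~-connected (vertex (inj₁ x)) (vertex (inj₁ y))))
    where
    root : Fin m ⊎ Fin k → Fin m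
    root = [ id , a ]

    contract : ∀ s t → Hanging R a s t → Star R (root s) (root t)
    contract (inj₁ x) (inj₁ y) r    = r ◅ ε
    contract (inj₁ x) (inj₂ j) refl = ε
    contract (inj₂ i) (inj₁ y) refl = ε

-- Changing labels, and isomorphisms from labels.

module _ {n m k : ℕ} {R : Rel (Fin m) 0ℓ} {a : Fin k → Fin m} {G : Graph n} where

  -- It serves to normalise `a`: moving a common attachment to a prescribed vertex, sorting pendant
  -- vertices by their side, and exchanging two sides.
  relabel : ∀ {m′ k′} {R′ : Rel (Fin m′) 0ℓ} {a′ : Fin k′ → Fin m′}
            (π : Fin m ↔ Fin m′) (σ : Fin k ↔ Fin k′) →
            (∀ x y → R x y ⇔ R′ (Inverse.to π x) (Inverse.to π y)) →
            (∀ i → Inverse.to π (a i) ≡ a′ (Inverse.to σ i)) →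
            Labelling R a G → Labelling R′ a′ G
  relabel {R′ = R′} {a′} π σ R⇔R′ πa≡a′σ L = record
    { bijection = ↔-trans L.bijection (π ⊎-↔ σ)
    ; adjacency = λ u v →
        mk⇔ (fwd (L.label u) (L.label v) ∘ Equivalence.to (L.adjacency u v))
            (Equivalence.from (L.adjacency u v) ∘ bwd (L.label u) (L.label v))
    }
    where
    module L = Labelling L
    module π = Inverse π
    module σ = Inverse σ
    π⊎σ = Sum.map π.to σ.to

    pull : ∀ {x i} → π.to x ≡ a′ (σ.to i) → x ≡ a i
    pull {x} {i} eq = trans (sym (π.strictlyInverseʳ x))
      (trans (cong π.from (trans eq (sym (πa≡a′σ i)))) (π.strictlyInverseʳ (a i)))

    fwd : ∀ s t → Hanging R a s t → Hanging R′ a′ (π⊎σ s) (π⊎σ t)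
    fwd (inj₁ x) (inj₁ y) r    = Equivalence.to (R⇔R′ x y) r
    fwd (inj₁ x) (inj₂ j) refl = πa≡a′σ j
    fwd (inj₂ i) (inj₁ y) refl = πa≡a′σ i

    bwd : ∀ s t → Hanging R′ a′ (π⊎σ s) (π⊎σ t) → Hanging R a s t
    bwd (inj₁ x) (inj₁ y) r = Equivalence.from (R⇔R′ x y) r
    bwd (inj₁ x) (inj₂ j) h = pull h
    bwd (inj₂ i) (inj₁ y) h = pull h

  labelling⇒≅ : ∀ {n′} {H : Graph n′} → Labelling R a G → Labelling R a H → G ≅ H
  labelling⇒≅ {H = H} L M = record
    { bijection = ↔-trans L.bijection (↔-sym M.bijection)
    ; adjacency = λ u v → mk⇔
        (λ e → M.edge _ _ (Equivalence.to (L.adjacency u v) e))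
        (λ e → Equivalence.from (L.adjacency u v) (M.edge⁻¹ _ _ e))
    }
    where
    module L = Labelling L
    module M = Labelling M

  labelling-≅ : ∀ {n′} {H : Graph n′} → H ≅ G → Labelling R a G → Labelling R a H
  labelling-≅ H≅G L = record
    { bijection = ↔-trans (_≅_.bijection H≅G) (Labelling.bijection L)
    ; adjacency = λ u v → mk⇔
        (Equivalence.to (Labelling.adjacency L _ _) ∘ Equivalence.to (_≅_.adjacency H≅G u v))
        (Equivalence.from (_≅_.adjacency H≅G u v) ∘ Equivalence.from (Labelling.adjacency L _ _))
    }

-- The labelling of a graph by its pendant vertices.

-- The pendant vertices are labelled last; each hangs at its only neighbour,
-- which is not pendant since a connected graph with adjacent pendant vertices
-- has just two vertices.
pendantLabelling : ∀ {n} (G : Graph n) → 3 ≤ n →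
  ∃ λ m → Σ[ a ∈ (Fin (#pendant G) → Fin m) ] Σ[ R ∈ Rel (Fin m) 0ℓ ] Σ[ L ∈ Labelling R a G ]
    ∀ x → degree G (Labelling.vertex L (inj₁ x)) ≢ 1
pendantLabelling {n} G 3≤n with separate (λ v → degree G v ℕ.≟ 1) (id {A = Fin n})
... | m , e , core-degree , pendant-degree =
  m , proj₁ ∘ attachment , (λ x y → from (inj₁ x) ~ from (inj₁ y)) ,
  record
    { bijection = e
    ; adjacency = λ u v → subst₂ (λ u′ v′ → u′ ~ v′ ⇔ Hanging _ _ (to u) (to v))
        (strictlyInverseʳ u) (strictlyInverseʳ v) (adjacency (to u) (to v))
    } ,
  core-degree
  where
  open Graph G
  open Inverse e using (to; from; strictlyInverseˡ; strictlyInverseʳ)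

  onlyNeighbour : ∀ i → ∃ (OnlyNeighbour G (from (inj₂ i)))
  onlyNeighbour i = degree≡1⇒onlyNeighbour G (pendant-degree i)

  no-pendant-edge : ∀ i j → ¬ from (inj₂ i) ~ from (inj₂ j)
  no-pendant-edge i j i~j =
    let w , i~w , only-i = onlyNeighbour i
        w′ , j~w′ , only-j = onlyNeighbour j
    in onlyNeighbour-asym G 3≤n
         (i~j , λ u i~u → trans (only-i u i~u) (sym (only-i _ i~j)))
         (~-sym i~j , λ u j~u → trans (only-j u j~u) (sym (only-j _ (~-sym i~j))))

  attachment : ∀ i → ∃ λ x → OnlyNeighbour G (from (inj₂ i)) (from (inj₁ x))
  attachment i with onlyNeighbour i
  ... | w , i~w , only with to w in eq
  ...   | inj₁ x = x , subst (OnlyNeighbour G _) (trans (sym (strictlyInverseʳ w)) (cong from eq))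
                             (i~w , only)
  ...   | inj₂ j = contradiction (subst (_ ~_) (trans (sym (strictlyInverseʳ w)) (cong from eq)) i~w)
                                 (no-pendant-edge i j)

  inj₁-from-injective : ∀ {x y} → from (inj₁ x) ≡ from (inj₁ y) → x ≡ y
  inj₁-from-injective eq = inj₁-injective
    (trans (sym (strictlyInverseˡ _)) (trans (cong to eq) (strictlyInverseˡ _)))

  adjacency : ∀ s t → from s ~ from t ⇔
              Hanging (λ x y → from (inj₁ x) ~ from (inj₁ y)) (proj₁ ∘ attachment) s t
  adjacency (inj₁ x) (inj₁ y) = mk⇔ id id
  adjacency (inj₁ x) (inj₂ j) = let y , j~y , only = attachment j in
    mk⇔ (λ x~j → inj₁-from-injective (only _ (~-sym x~j))) (λ { refl → ~-sym j~y })
  adjacency (inj₂ i) (inj₁ y) = let x , i~x , only = attachment i in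
    mk⇔ (λ i~y → inj₁-from-injective (only _ i~y)) (λ { refl → i~x })
  adjacency (inj₂ i) (inj₂ j) = mk⇔ (no-pendant-edge i j) λ ()

labelling-size : ∀ {n m k} {R : Rel (Fin m) 0ℓ} {a : Fin k → Fin m} {G : Graph n} → 
                 Labelling R a G → n ≡ m + k
labelling-size {m = m} L = ↔⇒≡ (↔-trans (Labelling.bijection L) (↔-sym (+↔⊎ {m})))

≢-⇔ : ∀ {m n} (π : Permutation m n) (x y : Fin m) → x ≢ y ⇔ Inverse.to π x ≢ Inverse.to π y
≢-⇔ π x y = mk⇔ (λ x≢y → x≢y ∘ Injection.injective (↔⇒↣ π)) (λ πx≢πy → πx≢πy ∘ cong (Inverse.to π))

-- The minimum for a general core: all pendant vertices at one vertex of a clique.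

∑≡0 : ∀ {n} (f : Fin n → ℕ) → ∑[ i < n ] f i ≡ 0 → ∀ i → f i ≡ 0
∑≡0 f ∑f≡0 zero    = ℕ.m+n≡0⇒m≡0 (f zero) ∑f≡0
∑≡0 f ∑f≡0 (suc i) = ∑≡0 (f ∘ suc) (ℕ.m+n≡0⇒n≡0 (f zero) ∑f≡0) i

split-pairs-const : ∀ {m} k (r : Fin m) → split-pairs {k = k} (const r) ≡ 0
split-pairs-const k r = begin
  ∑[ i < k ] ∑[ j < k ] [ r ≢ r ] ≡⟨ sum-cong-≗ {k} (λ _ → ∑-const k _) ⟩
  ∑[ i < k ] (k * [ r ≢ r ])      ≡⟨ ∑-const k _ ⟩
  k * (k * [ r ≢ r ])             ≡⟨ cong (λ z → k * (k * z)) (≢-refl r) ⟩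
  k * (k * 0)                     ≡⟨ cong (k *_) (ℕ.*-zeroʳ k) ⟩
  k * 0                           ≡⟨ ℕ.*-zeroʳ k ⟩
  0                               ∎
  where open ≡-Reasoning

-- Every term of the vanishing sum is 0, so each `a i` equals `a zero`. The given core vertex is the
-- witness when there are no pendant vertices.
split-pairs≡0⇒constant : ∀ {m k} (a : Fin k → Fin m) → split-pairs a ≡ 0 →
                         Fin m → ∃ λ r → ∀ i → a i ≡ r
split-pairs≡0⇒constant {k = zero}  a _  r = r , λ ()
split-pairs≡0⇒constant {k = suc k} a ≡0 _ =
  a zero , λ i → ≢-false⁻¹
    (∑≡0 (λ j → [ a i ≢ a j ]) (∑≡0 (λ i → ∑[ j < suc k ] [ a i ≢ a j ]) ≡0 i) zero)

addPendants-complete-labelling : ∀ m (r : Fin m) k →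
                                 Labelling _≢_ (const r) (addPendants (complete m) r k)
addPendants-complete-labelling m r k = record
  { bijection = +↔⊎
  ; adjacency = λ u v → same (splitAt m u) (splitAt m v)
  }
  where
  same : ∀ s t → Adj (complete m) r k s t ⇔ Hanging _≢_ (const r) s t
  same (inj₁ _) (inj₁ _) = mk⇔ id id
  same (inj₁ _) (inj₂ _) = mk⇔ id id
  same (inj₂ _) (inj₁ _) = mk⇔ id id
  same (inj₂ _) (inj₂ _) = mk⇔ id id

2*W-addPendants-complete : ∀ m (r : Fin m) k → 2 * W (addPendants (complete m) r k) ≡ δ-total m k
2*W-addPendants-complete m r k = begin
  2 * W (addPendants (complete m) r k)          ≡⟨ 2*W-complete (addPendants-complete-labelling m r k) id ⟩
  δ-total m k + split-pairs {k = k} (const r)   ≡⟨ cong (δ-total m k +_) (split-pairs-const k r) ⟩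
  δ-total m k + 0                               ≡⟨ ℕ.+-identityʳ _ ⟩
  δ-total m k                                   ∎
  where open ≡-Reasoning

-- Every permutation preserves a complete core, so the transposition of `r′` and `r` can move the
-- common attachment to `r`.
constant⇒≅-addPendants-complete : ∀ {n m k} {a : Fin k → Fin m} {G : Graph n} →
  Labelling _≢_ a G → (∃ λ r′ → ∀ i → a i ≡ r′) → (r : Fin m) → G ≅ addPendants (complete m) r k
constant⇒≅-addPendants-complete {m = m} {k} {a} L (r′ , a≡r′) r =
  labelling⇒≅ (relabel π ↔-refl (≢-⇔ π) (λ i → trans (cong (Inverse.to π) (a≡r′ i)) r′↦r) L)
              (addPendants-complete-labelling m r k)
  where
  π : Fin m ↔ Fin m
  π = transpose r′ r

  r′↦r : Inverse.to π r′ ≡ r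
  r′↦r rewrite dec-true (r′ ≟ r′) refl = refl

module _ {n m k : ℕ} {R : Rel (Fin m) 0ℓ} {a : Fin k → Fin m} {G : Graph n}
         (L : Labelling R a G) (r : Fin m) where

  W-addPendants-complete-≤ : W (addPendants (complete m) r k) ≤ W G
  W-addPendants-complete-≤ = ℕ.*-cancelˡ-≤ 2 (begin
    2 * W (addPendants (complete m) r k)  ≡⟨ 2*W-addPendants-complete m r k ⟩
    δ-total m k                           ≤⟨ ℕ.m≤m+n _ _ ⟩
    δ-total m k + split-pairs a           ≤⟨ 2*W-≥ L ⟩
    2 * W G                               ∎)
    where open ≤-Reasoning

  -- Equality is exploited twice: it makes the lower bound tight, hence the core complete, and then
  -- the exact formula for a complete core leaves 0 for `split-pairs a`.
  W≡⇒≅-addPendants-complete : W (addPendants (complete m) r k) ≡ W G → G ≅ addPendants (complete m) r k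
  W≡⇒≅-addPendants-complete W≡ =
    constant⇒≅-addPendants-complete (clique L complete′) (split-pairs≡0⇒constant a no-split r) r
    where
    2*W≡ : 2 * W G ≡ δ-total m k
    2*W≡ = trans (cong (2 *_) (sym W≡)) (2*W-addPendants-complete m r k)

    complete′ : ∀ {x y} → x ≢ y → R x y
    complete′ = 2*W-tight⇒complete L (ℕ.≤-trans (≤-reflexive 2*W≡) (ℕ.m≤m+n _ _))

    no-split : split-pairs a ≡ 0
    no-split = ℕ.+-cancelˡ-≡ (δ-total m k) _ _
      (trans (sym (2*W-complete L complete′)) (trans 2*W≡ (sym (ℕ.+-identityʳ _))))

-- The closed form for the clique with pendant vertices.

n*pred[n]+n≡n*n : ∀ n → n * pred n + n ≡ n * n
n*pred[n]+n≡n*n zero    = refl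
n*pred[n]+n≡n*n (suc n) = lemma n
  where
  lemma : ∀ n → suc n * n + suc n ≡ suc n * suc n
  lemma = solve-∀

-- Induction by Pascal's rule, doubled to stay free of division.
2*nC2≡n*pred[n] : ∀ n → 2 * (n C 2) ≡ n * pred n
2*nC2≡n*pred[n] zero    = refl
2*nC2≡n*pred[n] (suc n) = begin
  2 * (suc n C 2)           ≡⟨ cong (2 *_) (nCk+nC[k+1]≡[n+1]C[k+1] n 1) ⟨
  2 * (n C 1 + n C 2)       ≡⟨ cong (λ z → 2 * (z + n C 2)) (nC1≡n n) ⟩
  2 * (n + n C 2)           ≡⟨ ℕ.*-distribˡ-+ 2 n (n C 2) ⟩
  2 * n + 2 * (n C 2)       ≡⟨ cong (2 * n +_) (2*nC2≡n*pred[n] n) ⟩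
  2 * n + n * pred n        ≡⟨ rearrange n (n * pred n) ⟩
  n + (n * pred n + n)      ≡⟨ cong (n +_) (n*pred[n]+n≡n*n n) ⟩
  suc n * n                 ∎
  where
  open ≡-Reasoning
  rearrange : ∀ n z → 2 * n + z ≡ n + (z + n)
  rearrange = solve-∀

-- The core vertex makes `m` positive, so that `m + pred m` is one more than twice `m ∸ 1`. That
-- extra one, summed over the mixed blocks, raises `2 * (k * pred k)` to `2 * (k * k)`.
δ-total-closed : ∀ {m} k → Fin m → δ-total m k ≡ 2 * ((m C 2) + k ^ 2 + 2 * k * (m ∸ 1))
δ-total-closed {suc m} k _ = begin
  suc m * m + (2 * (k * (suc m + m)) + 2 * (k * pred k))    ≡⟨ split m k (k * pred k) ⟩
  suc m * m + (2 * (k * pred k + k) + 4 * (k * m))          ≡⟨ cong₂ (λ z w → z + (2 * w + 4 * (k * m)))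
                                                                 (sym (2*nC2≡n*pred[n] (suc m))) (n*pred[n]+n≡n*n k) ⟩
  2 * (suc m C 2) + (2 * (k * k) + 4 * (k * m))             ≡⟨ join′ (suc m C 2) k m ⟩
  2 * ((suc m C 2) + k ^ 2 + 2 * k * m)                     ∎
  where
  open ≡-Reasoning
  split : ∀ m k z → suc m * m + (2 * (k * (suc m + m)) + 2 * z) ≡ suc m * m + (2 * (z + k) + 4 * (k * m))
  split = solve-∀
  join′ : ∀ z k m → 2 * z + (2 * (k * k) + 4 * (k * m)) ≡ 2 * (z + k * (k * 1) + 2 * k * m)
  join′ = solve-∀

W-addPendants-complete : ∀ m (r : Fin m) k →
  W (addPendants (complete m) r k) ≡ (m C 2) + k ^ 2 + 2 * k * (m ∸ 1)
W-addPendants-complete m r k =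
  ℕ.*-cancelˡ-≡ (W (addPendants (complete m) r k)) ((m C 2) + k ^ 2 + 2 * k * (m ∸ 1)) 2
    (trans (2*W-addPendants-complete m r k) (δ-total-closed k r))

-- Cores with two vertices: double stars.

side : ∀ {b c} → Fin b ⊎ Fin c → Fin 2
side = [ const zero , const (suc zero) ]

-- The normal form of an attachment to a two-vertex core. With a complete core and `b`, `c` positive
-- the labelled graph is the tree T(b, c, 2).
twoSided : ∀ b c → Fin (b + c) → Fin 2
twoSided b c = side ∘ splitAt b

split-pairs-twoSided : ∀ b c → split-pairs (twoSided b c) ≡ 2 * (b * c)
split-pairs-twoSided b c = begin
  split-pairs (twoSided b c)
    ≡⟨ ∑∑-⊎ (+↔⊎ {b} {c}) (λ s t → [ side s ≢ side t ]) ⟩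
  (∑[ i < b ] ∑[ j < b ] 0 + ∑[ i < b ] ∑[ j < c ] 1)
      + (∑[ i < c ] ∑[ j < b ] 1 + ∑[ i < c ] ∑[ j < c ] 0)
    ≡⟨ cong₂ _+_ (cong₂ _+_ (block b b 0) (block b c 1)) (cong₂ _+_ (block c b 1) (block c c 0)) ⟩
  (b * (b * 0) + b * (c * 1)) + (c * (b * 1) + c * (c * 0))
    ≡⟨ collect b c ⟩
  2 * (b * c)
    ∎
  where
  open ≡-Reasoning
  block : ∀ p q z → ∑[ i < p ] ∑[ j < q ] z ≡ p * (q * z)
  block p q z = trans (sum-cong-≗ {p} (λ _ → ∑-const q z)) (∑-const p (q * z))
  collect : ∀ b c → (b * (b * 0) + b * (c * 1)) + (c * (b * 1) + c * (c * 0)) ≡ 2 * (b * c)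
  collect = solve-∀

2*W-twoSided : ∀ b c {n} {G : Graph n} → Labelling _≢_ (twoSided b c) G →
               2 * W G ≡ δ-total 2 (b + c) + 2 * (b * c)
2*W-twoSided b c L = trans (2*W-complete L id) (cong (δ-total 2 (b + c) +_) (split-pairs-twoSided b c))

-- The two core vertices are exchanged together with the two blocks of pendant vertices, so a double
-- star with its single leaf on the second side also reaches the form of T(1, q, 2).
twoSided-swap : ∀ b c {n} {G : Graph n} → Labelling _≢_ (twoSided b c) G → Labelling _≢_ (twoSided c b) G
twoSided-swap b c = relabel π
  (↔-trans (+↔⊎ {b}) (↔-trans (⊎-comm _ _) (↔-sym (+↔⊎ {c}))))
  (≢-⇔ π)
  (λ i → trans (flip-side (splitAt b i)) (cong side (sym (splitAt-join c b (Sum.swap (splitAt b i))))))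
  where
  π : Fin 2 ↔ Fin 2
  π = transpose zero (suc zero)
  flip-side : ∀ (s : Fin b ⊎ Fin c) → Inverse.to π (side s) ≡ side (Sum.swap s)
  flip-side (inj₁ _) = refl
  flip-side (inj₂ _) = refl

Fin2-third : ∀ {x y z : Fin 2} → x ≢ y → x ≢ z → y ≡ z
Fin2-third {zero}     {zero}     {_}        x≢y _   = contradiction refl x≢y
Fin2-third {zero}     {suc zero} {zero}     _   x≢z = contradiction refl x≢z
Fin2-third {zero}     {suc zero} {suc zero} _   _   = refl
Fin2-third {suc zero} {zero}     {zero}     _   _   = refl
Fin2-third {suc zero} {zero}     {suc zero} _   x≢z = contradiction refl x≢z
Fin2-third {suc zero} {suc zero} {_}        x≢y _   = contradiction refl x≢y

-- The core is connected, and the first step of a core walk from `x` can lead only to the other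
-- vertex, which is `y`.
core-of-two-complete : ∀ {n k R} {a : Fin k → Fin 2} {G : Graph n} → Labelling R a G →
                       ∀ {x y} → x ≢ y → R x y
core-of-two-complete {R = R} L {x} {y} x≢y with core-connected L x y
... | ε     = contradiction refl x≢y
... | r ◅ _ = subst (R x) (Fin2-third (λ { refl → core-irrefl L r }) x≢y) r

-- With nothing hanging at `x`, its only neighbour is the other core vertex. Such an `x` would
-- itself be pendant, which is how both sides are shown to be occupied.
bare-core-of-two : ∀ {n k} {a : Fin k → Fin 2} {G : Graph n} (L : Labelling _≢_ a G) →
                   {x y : Fin 2} → x ≢ y → (∀ i → a i ≢ x) → degree G (Labelling.vertex L (inj₁ x)) ≡ 1
bare-core-of-two {G = G} L {x} {y} x≢y bare =
  onlyNeighbour⇒degree≡1 G (edge (inj₁ x) (inj₁ y) x≢y , only)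
  where
  open Graph G
  open Labelling L
  hanging : ∀ s → Hanging _≢_ _ (inj₁ x) s → s ≡ inj₁ y
  hanging (inj₁ z) x≢z = cong inj₁ (Fin2-third x≢z x≢y)
  hanging (inj₂ i) x≡ai = contradiction (sym x≡ai) (bare i)

  only : ∀ u → vertex (inj₁ x) ~ u → u ≡ vertex (inj₁ y)
  only u x~u = trans (sym (strictlyInverseʳ u)) (cong vertex
    (hanging (label u) (edge⁻¹ (inj₁ x) (label u) (subst (_ ~_) (sym (strictlyInverseʳ u)) x~u))))

module _ {n k : ℕ} {R : Rel (Fin 2) 0ℓ} {a : Fin k → Fin 2} {G : Graph n} (L : Labelling R a G)
         (core-degree : ∀ x → degree G (Labelling.vertex L (inj₁ x)) ≢ 1) where

  twoSidedLabelling : ∃₂ λ b c → k ≡ suc b + suc c × Labelling _≢_ (twoSided (suc b) (suc c)) G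
  twoSidedLabelling with separate (λ i → a i ≟ suc zero) (id {A = Fin k})
  -- Sorting the pendant vertices leaves the core labels fixed, so `core-degree` applies to `sorted`
  -- as it stands.
  ... | b , e , a≢1 , a≡1 = both b _ sorted core-degree (↔⇒≡ (↔-trans e (↔-sym (+↔⊎ {b}))))
    where
    open Inverse e using (to; from; strictlyInverseʳ)

    side-to : ∀ i → a i ≡ side (to i)
    side-to i with to i in eq
    ... | inj₁ x = Fin2-third (λ 1≡ai → a≢1 x (trans (cong a i≡) (sym 1≡ai))) λ ()
      where
      i≡ : from (inj₁ x) ≡ i
      i≡ = trans (cong from (sym eq)) (strictlyInverseʳ i)
    ... | inj₂ j = trans (cong a (trans (sym (strictlyInverseʳ i)) (cong from eq))) (a≡1 j)

    sorted : Labelling _≢_ (twoSided b _) G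
    sorted = relabel ↔-refl (↔-trans e (↔-sym (+↔⊎ {b}))) (λ _ _ → mk⇔ id id)
      (λ i → trans (side-to i) (cong side (sym (splitAt-join b _ (to i)))))
      (clique L (core-of-two-complete L))

    both : ∀ b c (M : Labelling _≢_ (twoSided b c) G) →
           (∀ x → degree G (Labelling.vertex M (inj₁ x)) ≢ 1) → k ≡ b + c →
           ∃₂ λ b c → k ≡ suc b + suc c × Labelling _≢_ (twoSided (suc b) (suc c)) G
    both zero    c       M deg k≡ = contradiction
      (bare-core-of-two M {zero} {suc zero} (λ ()) (λ _ ())) (deg zero)
    both (suc b) zero    M deg k≡ = contradiction
      (bare-core-of-two M {suc zero} {zero} (λ ()) right-bare) (deg (suc zero))
      where
      right-bare : ∀ i → twoSided (suc b) 0 i ≢ suc zero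
      right-bare i with splitAt (suc b) i
      ... | inj₁ _ = λ ()
    both (suc b) (suc c) M deg k≡ = b , c , k≡ , M

-- `T` adds its leaves in two rounds, whereas the label is a single `splitAt 2`. The two adjacencies
-- are compared on the path vertices 0 and 1, the single leaf 2 at vertex 0, and the later leaves at
-- vertex 1.
T-labelling : ∀ q → Labelling _≢_ (twoSided 1 (suc q)) (T 1 (suc q) 2)
T-labelling q = record
  { bijection = +↔⊎ {2}
  ; adjacency = adjacency
  }
  where
  open Graph (T 1 (suc q) 2)
  adjacency : ∀ u v → u ~ v ⇔ Hanging _≢_ (twoSided 1 (suc q)) (splitAt 2 u) (splitAt 2 v)
  adjacency zero                zero                = mk⇔ (λ { (inj₁ ()) ; (inj₂ ()) }) (λ ≢ → contradiction refl ≢)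
  adjacency zero                (suc zero)          = mk⇔ (λ _ ()) (λ _ → inj₁ refl)
  adjacency zero                (suc (suc zero))    = mk⇔ (λ _ → refl) (λ _ → refl)
  adjacency zero                (suc (suc (suc _))) = mk⇔ (λ ()) (λ ())
  adjacency (suc zero)          zero                = mk⇔ (λ _ ()) (λ _ → inj₂ refl)
  adjacency (suc zero)          (suc zero)          = mk⇔ (λ { (inj₁ ()) ; (inj₂ ()) }) (λ ≢ → contradiction refl ≢)
  adjacency (suc zero)          (suc (suc zero))    = mk⇔ (λ ()) (λ ())
  adjacency (suc zero)          (suc (suc (suc _))) = mk⇔ (λ _ → refl) (λ _ → refl)
  adjacency (suc (suc zero))    zero                = mk⇔ (λ _ → refl) (λ _ → refl)
  adjacency (suc (suc zero))    (suc zero)          = mk⇔ (λ ()) (λ ())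
  adjacency (suc (suc zero))    (suc (suc zero))    = mk⇔ (λ ()) (λ ())
  adjacency (suc (suc zero))    (suc (suc (suc _))) = mk⇔ (λ ()) (λ ())
  adjacency (suc (suc (suc _))) zero                = mk⇔ (λ ()) (λ ())
  adjacency (suc (suc (suc _))) (suc zero)          = mk⇔ (λ _ → refl) (λ _ → refl)
  adjacency (suc (suc (suc _))) (suc (suc zero))    = mk⇔ (λ ()) (λ ())
  adjacency (suc (suc (suc _))) (suc (suc (suc _))) = mk⇔ (λ ()) (λ ())

-- With the number of leaves fixed, the product `suc b * suc c` exceeds `1 * suc (b + c)` by exactly
-- `b * c`. This excess yields both the inequality and the equality case.
twoSided-arithmetic : ∀ b c {w h} → 2 * w ≡ δ-total 2 (suc b + suc c) + 2 * (suc b * suc c) →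
  2 * h ≡ δ-total 2 (2 + (b + c)) + 2 * (1 * suc (b + c)) → w ≡ h + b * c
twoSided-arithmetic b c {w} {h} 2w≡ 2h≡ = ℕ.*-cancelˡ-≡ w (h + b * c) 2 (begin
  2 * w                                             ≡⟨ 2w≡ ⟩
  δ-total 2 (suc b + suc c) + 2 * (suc b * suc c)   ≡⟨ cong₂ _+_ (cong (δ-total 2 ∘ suc) (ℕ.+-suc b c))
                                                                (expand b c) ⟩
  t + (2 * (1 * suc (b + c)) + 2 * (b * c))         ≡⟨ ℕ.+-assoc t _ _ ⟨
  t + 2 * (1 * suc (b + c)) + 2 * (b * c)           ≡⟨ cong (_+ 2 * (b * c)) 2h≡ ⟨
  2 * h + 2 * (b * c)                               ≡⟨ ℕ.*-distribˡ-+ 2 h _ ⟨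
  2 * (h + b * c)                                   ∎)
  where
  open ≡-Reasoning
  t = δ-total 2 (2 + (b + c))
  expand : ∀ b c → 2 * (suc b * suc c) ≡ 2 * (1 * suc (b + c)) + 2 * (b * c)
  expand = solve-∀

module _ (b c : ℕ) {n n′ : ℕ} {G : Graph n} {H : Graph n′}
         (L : Labelling _≢_ (twoSided (suc b) (suc c)) G)
         (M : Labelling _≢_ (twoSided 1 (suc (b + c))) H) where

  W-twoSided : W G ≡ W H + b * c
  W-twoSided = twoSided-arithmetic b c (2*W-twoSided (suc b) (suc c) L) (2*W-twoSided 1 (suc (b + c)) M)

  W≡⇒≅-twoSided : W H ≡ W G → G ≅ H
  W≡⇒≅-twoSided W≡ = go M (ℕ.m*n≡0⇒m≡0∨n≡0 b (ℕ.+-cancelˡ-≡ (W H) (b * c) 0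
                   (trans (sym W-twoSided) (trans (sym W≡) (sym (ℕ.+-identityʳ (W H)))))))
    where
    go : Labelling _≢_ (twoSided 1 (suc (b + c))) H → b ≡ 0 ⊎ c ≡ 0 → G ≅ H
    go M (inj₁ refl) = labelling⇒≅ L M
    go M (inj₂ refl) = labelling⇒≅ (twoSided-swap (suc b) 1 L)
      (subst (λ q → Labelling _≢_ (twoSided 1 (suc q)) H) (ℕ.+-identityʳ b) M)

W-twoSided-1 : ∀ q {n} {H : Graph n} → Labelling _≢_ (twoSided 1 (suc q)) H →
               W H ≡ (4 + q) ^ 2 ∸ (4 + q) ∸ 2
W-twoSided-1 q {H = H} L = begin
  W H                                       ≡⟨ ℕ.*-cancelˡ-≡ (W H) w 2 (trans (2*W-twoSided 1 (suc q) L) (closed q)) ⟩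
  w                                         ≡⟨ ℕ.m+n∸m≡n 2 w ⟨
  2 + w ∸ 2                                 ≡⟨ cong (_∸ 2) (ℕ.m+n∸m≡n (4 + q) (2 + w)) ⟨
  4 + q + (2 + w) ∸ (4 + q) ∸ 2             ≡⟨ cong (λ z → z ∸ (4 + q) ∸ 2) (square q) ⟨
  (4 + q) ^ 2 ∸ (4 + q) ∸ 2                 ∎
  where
  open ≡-Reasoning
  -- This is `n ^ 2 - n - 2` expanded at `n = 4 + q`; exhibiting the square as `n + (2 + w)` makes
  -- both truncated subtractions exact.
  w = 10 + 7 * q + q * q
  closed : ∀ q → 2 * 1 + (2 * ((2 + q) * (2 + 1)) + 2 * ((2 + q) * suc q)) + 2 * (1 * suc q) ≡
           2 * (10 + 7 * q + q * q)
  closed = solve-∀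
  square : ∀ q → (4 + q) * ((4 + q) * 1) ≡ 4 + q + (2 + (10 + 7 * q + q * q))
  square = solve-∀

-- The two cases of the theorem.

PendantLabelling : ∀ {n} → Graph n → ℕ → Set₁
PendantLabelling {n} G k =
  ∃ λ m → n ≡ m + k × Σ[ a ∈ (Fin k → Fin m) ] Σ[ R ∈ Rel (Fin m) 0ℓ ] Σ[ L ∈ Labelling R a G ]
    ∀ x → degree G (Labelling.vertex L (inj₁ x)) ≢ 1

-- The number of pendant vertices is replaced by `k` here, where `k` is a variable and the
-- membership can be matched with `refl`.
ℌ-labelling : ∀ {n k} {G : Graph n} → 3 ≤ n → G ∈ ℌ n k → PendantLabelling G k
ℌ-labelling {G = G} 3≤n refl =
  let m , a , R , L , core-degree = pendantLabelling G 3≤n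
  in m , labelling-size L , a , R , L , core-degree

-- The isomorphism pulls the labelling of `H` back to `G`, and for a complete core `2 * W` is
-- determined by `a`.
≅⇒W≡ : ∀ {n n′ m k} {a : Fin k → Fin m} {G : Graph n} {H : Graph n′} →
       Labelling _≢_ a H → G ≅ H → W H ≡ W G
≅⇒W≡ {G = G} {H} L G≅H = ℕ.*-cancelˡ-≡ (W H) (W G) 2
  (trans (2*W-complete L id) (sym (2*W-complete (labelling-≅ G≅H L) id)))

clique-case : ∀ {n k} (G : Graph n) → 3 ≤ n → G ∈ ℌ n k → (r : Fin (n ∸ k)) →
  let H = addPendants (complete (n ∸ k)) r k in W H ≤ W G × (W H ≡ W G ⇔ G ≅ H)
clique-case {n} {k} G 3≤n G∈ = from-labelling (ℌ-labelling 3≤n G∈)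
  where
  conclude : ∀ {m R} {a : Fin k → Fin m} → Labelling R a G → (r : Fin m) →
    let H = addPendants (complete m) r k in W H ≤ W G × (W H ≡ W G ⇔ G ≅ H)
  conclude L r =
    W-addPendants-complete-≤ L r ,
    mk⇔ (W≡⇒≅-addPendants-complete L r) (≅⇒W≡ (addPendants-complete-labelling _ r k))

  from-labelling : PendantLabelling G k → (r : Fin (n ∸ k)) →
    let H = addPendants (complete (n ∸ k)) r k in W H ≤ W G × (W H ≡ W G ⇔ G ≅ H)
  from-labelling (m , n≡m+k , a , R , L , _) =
    -- The core size `m` equals `n ∸ k` only propositionally, so the conclusion is proved for every
    -- root in `Fin m` and then transported.
    subst (λ m → (r : Fin m) →
            let H = addPendants (complete m) r k in W H ≤ W G × (W H ≡ W G ⇔ G ≅ H))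
          (trans (sym (ℕ.m+n∸n≡m m k)) (cong (_∸ k) (sym n≡m+k))) (conclude L)

double-star-case : ∀ q {n} {H : Graph n} → Labelling _≢_ (twoSided 1 (suc q)) H →
  (G : Graph (4 + q)) → G ∈ ℌ (4 + q) (2 + q) → W H ≤ W G × (W H ≡ W G ⇔ G ≅ H)
double-star-case q {H = H} N G G∈ = from-labelling (ℌ-labelling (s≤s (s≤s (s≤s z≤n))) G∈)
  where
  conclude : ∀ b c → 2 + q ≡ suc b + suc c → Labelling _≢_ (twoSided (suc b) (suc c)) G →
             W H ≤ W G × (W H ≡ W G ⇔ G ≅ H)
  conclude b c k≡ M =
    ≤-trans (ℕ.m≤m+n (W H) (b * c)) (≤-reflexive (sym (W-twoSided b c M N′))) ,
    mk⇔ (W≡⇒≅-twoSided b c M N′) (≅⇒W≡ N)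
    where
    N′ : Labelling _≢_ (twoSided 1 (suc (b + c))) H
    N′ = subst (λ q → Labelling _≢_ (twoSided 1 (suc q)) H)
               (ℕ.suc-injective (ℕ.suc-injective (trans k≡ (cong suc (ℕ.+-suc b c))))) N

  from-labelling : PendantLabelling G (2 + q) → W H ≤ W G × (W H ≡ W G ⇔ G ≅ H)
  -- Cancelling the `2 + q` pendant vertices from `4 + q` leaves a core of two vertices.
  from-labelling (m , n≡ , a , R , L , core-degree) with ℕ.+-cancelʳ-≡ (2 + q) 2 m n≡
  ... | refl =
    let b , c , k≡ , M = twoSidedLabelling L core-degree
    in conclude b c k≡ M

theorem1p2 : ∀ (n k : ℕ) (4≤n : 4 ≤ n) → k ≤ n ∸ 2 →
    ((k≤n∸3 : k ≤ n ∸ 3) →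
    (∀ (G : Graph n) → G ∈ ℌ n k →
    W (P n k 4≤n k≤n∸3) ≤ W G
    × (W (P n k 4≤n k≤n∸3) ≡ W G ⇔ G ≅ P n k 4≤n k≤n∸3))
    × W (P n k 4≤n k≤n∸3) ≡ ((n ∸ k) C 2) + k ^ 2 + 2 * k * (n ∸ k ∸ 1))
    ×
    (k ≡ n ∸ 2 →
    let instance n∸3≢0 = 4≤n⇒n∸3≢0 4≤n in
    (∀ (G : Graph n) → G ∈ ℌ n k →
    W (T 1 (n ∸ 3) 2) ≤ W G
    × (W (T 1 (n ∸ 3) 2) ≡ W G ⇔ G ≅ T 1 (n ∸ 3) 2))
    × W (T 1 (n ∸ 3) 2) ≡ n ^ 2 ∸ n ∸ 2)
theorem1p2 n k 4≤n@(s≤s (s≤s (s≤s (s≤s {n = q} _)))) _ =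
  (λ k≤n∸3 → let r = fromℕ< (0<n∸k 4≤n k≤n∸3) in
    (λ G G∈ → clique-case G (s≤s (s≤s (s≤s z≤n))) G∈ r) ,
    W-addPendants-complete (n ∸ k) r k) ,
  -- Since `n` is matched as `4 + q`, `n ∸ 2` and `n ∸ 3` compute to `2 + q` and `suc q`.
  λ { refl → double-star-case q {H = T 1 (suc q) 2} (T-labelling q) ,
             W-twoSided-1 q {H = T 1 (suc q) 2} (T-labelling q) }
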